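{- Let $G$ be an embedded graph, let $\alpha,\beta,\gamma\in\mathbb{C}$, and let $k\in\mathbb{N}$. Then $$Q(G;(\alpha,\beta,\gamma),k)=\sum_{\phi\in\mathcal{K}(G_m,k)}(\alpha+\beta+\gamma)^{\mathrm{tot}(\phi)}\,\alpha^{\mathrm{wh}(\phi)}\,\beta^{\mathrm{bl}(\phi)}\,\gamma^{\mathrm{cr}(\phi)}.$$
   Context: An embedded graph is a graph (loops and multiple edges allowed, not necessarily connected) cellularly embedded in a closed, possibly non-orientable, surface, i.e. each component of the complement (each face) is an open disc; embedded graphs are considered up to homeomorphism of surfaces that carries one graph to the other. Equivalently, it is a ribbon graph. Medial graph: $G_m$ is the 4-regular graph embedded in the same surface obtained by placing a vertex $v_e$ on each edge $e$ of $G$ and drawing the edges of $G_m$ by following the face boundaries of $G$. An isolated vertex of $G$ contributes a free loop (a circular edge with no vertex), which counts as an edge of $G_m$. The canonical checkerboard colouring of $G_m$ colours black the faces of $G_m$ containing a vertex of $G$ and colours white the remaining faces (which correspond to the faces of $G$). At a vertex $v$ of $G_m$ let $h_1,h_2,h_3,h_4$ be the four incident half-edges in cyclic order, labelled so that the corners between $h_1,h_2$ and between $h_3,h_4$ are white, and the corners between $h_2,h_3$ and between $h_4,h_1$ are black. A vertex state at $v$ is a pairing of these half-edges (with the paired half-edges joined and $v$ removed): the white smoothing is $\{h_1,h_2\},\{h_3,h_4\}$, the black smoothing is $\{h_2,h_3\},\{h_4,h_1\}$, the crossing is $\{h_1,h_3\},\{h_2,h_4\}$. A graph state $s$ of $G_m$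 is a choice of vertex state at every vertex; it yields a collection of closed curves (including any free loops), and $c(s)$ is the number of these curves. $\mathcal{S}(G_m)$ is the set of graph states. Topological transition polynomial: for $\alpha,\beta,\gamma\in\mathbb{C}$, $Q(G;(\alpha,\beta,\gamma),t)=\sum_{s\in\mathcal{S}(G_m)}\omega(s)t^{c(s)}\in\mathbb{C}[t]$, where $\omega(s)$ is the product over vertices of $G_m$ of $\alpha$ for each white smoothing, $\beta$ for each black smoothing, and $\gamma$ for each crossing in $s$. $k$-valuations: a $k$-valuation of $G_m$ is a map $\phi:E(G_m)\to\{1,\dots,k\}$ (free loops are coloured too) such that for every colour $i$ and every vertex $v$ the number of $i$-coloured half-edges at $v$ is even. $\mathcal{K}(G_m,k)$ is the set of $k$-valuations. At a vertex $v$ of $G_m$, with the four incident half-edges $h_1,h_2,h_3,h_4$ in cyclic order, labelled so that the corners between $h_1,h_2$ and between $h_3,h_4$ are white and the corners between $h_2,h_3$ and between $h_4,h_1$ are black in the canonical checkerboard colouring, $\phi$ is of type: total, if all four half-edges have the same colour; and otherwise two distinct colours occur, each twice, and the type is white if $h_1,h_2$ have the same colour and $h_3,h_4$ have the same colour; black if $h_2,h_3$ have the same colour and $h_4,h_1$ have the same colour; crossing if $h_1,h_3$ have the same colour and $h_2,h_4$ have the same colour. $\mathrm{tot}(\phi),\mathrm{wh}(\phi),\mathrm{bl}(\phi),\mathrm{cr}(\phi)$ are the numbers of vertices of $G_m$ of total, white, black, crossing type. Convention: $0^0=1$; $\mathbb{N}$ denotes the positive integers. -}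

module Defs where

open import Algebra.Bundles using (CommutativeRing)
import Algebra.Properties.Semiring.Exp as Exp
import Algebra.Properties.Semiring.Mult as Mult
open import Data.Fin using (Fin; combine; _↑ˡ_)
open import Data.Fin.Patterns using (0F; 1F; 2F; 3F)
open import Data.Fin.Properties using (all?; _≟_)
open import Data.List as List
  using (List; []; _∷_; [_]; length; filter; deduplicate; concatMap; foldr; cartesianProductWith; allFin)
open import Data.List.Membership.Propositional using (_∈_)
open import Data.List.Relation.Unary.All as All using (All)
open import Data.List.Relation.Unary.Any using (here; there)
open import Data.Nat using (ℕ; zero; suc; _+_; _*_)
open import Data.Nat.Divisibility using (_∣_; _∣?_)
open import Data.Nat.GeneralisedArithmetic using (iterate)
open import Data.Product using (∃; _×_; _,_)
open import Data.Sign using (Sign)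
open import Data.Sum using (_⊎_; inj₁; inj₂)
open import Data.Vec as Vec using (Vec; []; _∷_; lookup)
open import Function using (_↔_; _⇔_; Inverse)
open import Relation.Binary.Construct.Closure.Equivalence as EqC using (EqClosure)
open import Relation.Binary.Construct.Closure.ReflexiveTransitive using (ε; _◅_)
open import Relation.Binary.Construct.Closure.Symmetric using (fwd; bwd)
open import Relation.Binary.Definitions using (Decidable)
open import Relation.Binary.PropositionalEquality using (_≡_; _≢_; refl)
open import Relation.Nullary using (¬_; ¬?)
open import Relation.Nullary.Decidable using (map′; _×-dec_; _⊎-dec_)
import Relation.Unary as U

words : ∀ {a} {A : Set a} → List A → ∀ n → List (Vec A n)
words xs zero    = [ [] ]
words xs (suc n) = cartesianProductWith _∷_ xs (words xs n)

#_ : ∀ {n p} {P : U.Pred (Fin n) p} → U.Decidable P → ℕ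
# P? = length (filter P? (allFin _))

-- The equivalence relation generated by a finite list of pairs is decidable:
-- adding the pair (a , b) merges the classes of a and b.

module _ {n : ℕ} where

  Generated : List (Fin n × Fin n) → Fin n → Fin n → Set
  Generated ps = EqClosure (λ x y → (x , y) ∈ ps)

  private
    weaken : ∀ {p ps x y} → Generated ps x y → Generated (p ∷ ps) x y
    weaken = EqC.map there

    Merged : Fin n → Fin n → List (Fin n × Fin n) → Fin n → Fin n → Set
    Merged a b ps x y =
      Generated ps x y
        ⊎ (Generated ps x a × Generated ps b y)
        ⊎ (Generated ps x b × Generated ps a y)

    merge : ∀ {a b ps x y} → Merged a b ps x y → Generated ((a , b) ∷ ps) x y
    merge (inj₁ xy) = weaken xy
    merge (inj₂ (inj₁ (xa , by))) =
      EqC.transitive _ (weaken xa) (fwd (here refl) ◅ weaken by)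
    merge (inj₂ (inj₂ (xb , ay))) =
      EqC.transitive _ (weaken xb) (bwd (here refl) ◅ weaken ay)

    unmerge : ∀ {a b ps x y} → Generated ((a , b) ∷ ps) x y → Merged a b ps x y
    unmerge ε = inj₁ ε
    unmerge (fwd (here refl) ◅ r) with unmerge r
    ... | inj₁ by              = inj₂ (inj₁ (ε , by))
    ... | inj₂ (inj₁ (_ , by)) = inj₂ (inj₁ (ε , by))
    ... | inj₂ (inj₂ (_ , ay)) = inj₁ ay
    unmerge (bwd (here refl) ◅ r) with unmerge r
    ... | inj₁ ay              = inj₂ (inj₂ (ε , ay))
    ... | inj₂ (inj₁ (_ , by)) = inj₁ by
    ... | inj₂ (inj₂ (_ , ay)) = inj₂ (inj₂ (ε , ay))
    unmerge (fwd (there m) ◅ r) with unmerge r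
    ... | inj₁ q              = inj₁ (fwd m ◅ q)
    ... | inj₂ (inj₁ (q , s)) = inj₂ (inj₁ (fwd m ◅ q , s))
    ... | inj₂ (inj₂ (q , s)) = inj₂ (inj₂ (fwd m ◅ q , s))
    unmerge (bwd (there m) ◅ r) with unmerge r
    ... | inj₁ q              = inj₁ (bwd m ◅ q)
    ... | inj₂ (inj₁ (q , s)) = inj₂ (inj₁ (bwd m ◅ q , s))
    ... | inj₂ (inj₂ (q , s)) = inj₂ (inj₂ (bwd m ◅ q , s))

    discrete : ∀ {x y} → Generated [] x y → x ≡ y
    discrete ε            = refl
    discrete (fwd () ◅ _)
    discrete (bwd () ◅ _)

  generated? : ∀ ps → Decidable (Generated ps)
  generated? []             x y = map′ (λ { refl → ε }) discrete (x ≟ y)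
  generated? ((a , b) ∷ ps) x y = map′ merge unmerge
    (generated? ps x y
      ⊎-dec (generated? ps x a ×-dec generated? ps b y)
      ⊎-dec (generated? ps x b ×-dec generated? ps a y))

-- Cellular embeddings in closed, possibly non-orientable, possibly
-- disconnected surfaces are encoded by signed rotation systems.  A dart
-- (e , a) is the end a of the edge e.  Fix a local orientation at every
-- vertex: `rotation` sends a dart to the next dart around its vertex, and
-- `signature e` is + when the two local orientations agree along e and
-- - when they do not.  An isolated vertex is embedded in a sphere of its own.

record Graph : Set where
  field
    V E      : ℕ
    endpoint : Fin E × Fin 2 → Fin V

  Dart : Set
  Dart = Fin E × Fin 2

record EmbeddedGraph : Set where
  field
    graph : Graph
  open Graph graph public
  field
    rotation       : Dart ↔ Dart
    rotation-cycle : ∀ d d′ →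
      endpoint d ≡ endpoint d′ ⇔ ∃ λ n → iterate (Inverse.to rotation) d n ≡ d′
    signature      : Fin E → Sign

-- The half-edges h₁, h₂, h₃, h₄ at a vertex of the medial graph are
-- 0F, 1F, 2F, 3F: in cyclic order, with white corners h₁h₂, h₃h₄ and black
-- corners h₂h₃, h₄h₁.

data VertexState : Set where
  white black crossing : VertexState

pairing : VertexState → List (Fin 4 × Fin 4)
pairing white    = (0F , 1F) ∷ (2F , 3F) ∷ []
pairing black    = (1F , 2F) ∷ (3F , 0F) ∷ []
pairing crossing = (0F , 2F) ∷ (1F , 3F) ∷ []

module Medial (G : EmbeddedGraph) where
  open EmbeddedGraph G

  Isolated : Fin V → Set
  Isolated v = ∀ e a → endpoint (e , a) ≢ v

  isolated? : U.Decidable Isolated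
  isolated? v = all? λ e → all? λ a → ¬? (endpoint (e , a) ≟ v)

  -- The vertices of the medial graph are the edges of G.  Its edges are the
  -- corners of G, one for each dart d (the corner between d and the next dart
  -- around its vertex), followed by one free loop for each isolated vertex.

  Vₘ Eₘ : ℕ
  Vₘ = E
  Eₘ = E * 2 + # isolated?

  corner : Dart → Fin Eₘ
  corner (e , a) = combine e a ↑ˡ # isolated?

  after before : Dart → Fin Eₘ
  after d  = corner d
  before d = corner (Inverse.from rotation d)

  -- The edges carrying h₁, h₂, h₃, h₄ at the medial vertex on e.  Going round
  -- the midpoint of e, start at the end 0F on the side `after`, pass to the
  -- end 1F on the same side of e (crossing a face of G, so a white corner),
  -- then to the other side of e (crossing the vertex of G at the end 1F, so a
  -- black corner), and back to the end 0F.  When the local orientations agree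
  -- along e, the side after one end is the side before the other end.

  halfEdges : Fin Vₘ → Vec (Fin Eₘ) 4
  halfEdges e with signature e
  ... | Sign.+ = after (e , 0F) ∷ before (e , 1F) ∷ after  (e , 1F) ∷ before (e , 0F) ∷ []
  ... | Sign.- = after (e , 0F) ∷ after  (e , 1F) ∷ before (e , 1F) ∷ before (e , 0F) ∷ []

  edgeAt : Fin Vₘ → Fin 4 → Fin Eₘ
  edgeAt v = lookup (halfEdges v)

  GraphState : Set
  GraphState = Vec VertexState Vₘ

  graphStates : List GraphState
  graphStates = words (white ∷ black ∷ crossing ∷ []) Vₘ

  -- A curve of the state s is made of the medial edges joined, end to end, by
  -- the pairings of s; curves are the classes of the generated equivalence.

  joins : GraphState → List (Fin Eₘ × Fin Eₘ)
  joins s = concatMap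
    (λ v → List.map (λ { (p , q) → edgeAt v p , edgeAt v q }) (pairing (lookup s v)))
    (allFin Vₘ)

  c : GraphState → ℕ
  c s = length (deduplicate (generated? (joins s)) (allFin Eₘ))

  module _ {k : ℕ} where

    Colouring : Set
    Colouring = Vec (Fin k) Eₘ

    colours : Colouring → Fin Vₘ → Vec (Fin k) 4
    colours φ v = Vec.map (lookup φ) (halfEdges v)

    IsValuation : Colouring → Set
    IsValuation φ = ∀ i v → 2 ∣ Vec.count (i ≟_) (colours φ v)

    isValuation? : U.Decidable IsValuation
    isValuation? φ = all? λ i → all? λ v → 2 ∣? Vec.count (i ≟_) (colours φ v)

    Same : Colouring → Fin Vₘ → Fin 4 × Fin 4 → Set
    Same φ v (p , q) = lookup (colours φ v) p ≡ lookup (colours φ v) q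

    same? : ∀ φ v → U.Decidable (Same φ v)
    same? φ v (p , q) = lookup (colours φ v) p ≟ lookup (colours φ v) q

    Total : Colouring → Fin Vₘ → Set
    Total φ v = ∀ p q → Same φ v (p , q)

    total? : ∀ φ → U.Decidable (Total φ)
    total? φ v = all? λ p → all? λ q → same? φ v (p , q)

    -- For a valuation: exactly one of Total, OfType white, OfType black and
    -- OfType crossing holds at each vertex.
    OfType : VertexState → Colouring → Fin Vₘ → Set
    OfType x φ v = ¬ Total φ v × All (Same φ v) (pairing x)

    ofType? : ∀ x φ → U.Decidable (OfType x φ)
    ofType? x φ v = ¬? (total? φ v) ×-dec All.all? (same? φ v) (pairing x)

    tot wh bl cr : Colouring → ℕ
    tot φ = # total? φ
    wh  φ = # ofType? white φ
    bl  φ = # ofType? black φ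
    cr  φ = # ofType? crossing φ

  𝒦 : ∀ k → List (Vec (Fin k) Eₘ)
  𝒦 k = filter isValuation? (words (allFin k) Eₘ)

open Medial public using (𝒦; tot; wh; bl; cr)

module Transition {r ℓ} (R : CommutativeRing r ℓ) where
  open CommutativeRing R renaming (_+_ to _⊕_; _*_ to _⊛_)
  open Exp semiring public using (_^_)
  open Mult semiring using () renaming (_×_ to _·_)

  fromℕ : ℕ → Carrier
  fromℕ n = n · 1#

  sumOver : ∀ {a} {A : Set a} → List A → (A → Carrier) → Carrier
  sumOver xs f = foldr (λ x acc → f x ⊕ acc) 0# xs

  infix 6 sumOver
  syntax sumOver xs (λ x → y) = ∑[ x ∈ xs ] y

  module _ (α β γ : Carrier) where

    weight : VertexState → Carrier
    weight white    = α
    weight black    = β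
    weight crossing = γ

    ω : ∀ {n} → Vec VertexState n → Carrier
    ω s = Vec.foldr′ _⊛_ 1# (Vec.map weight s)

  -- The topological transition polynomial, as a function of its variable t.
  Q : EmbeddedGraph → Carrier × Carrier × Carrier → Carrier → Carrier
  Q G (α , β , γ) t = ∑[ s ∈ graphStates ] (ω α β γ s ⊛ t ^ c s)
    where open Medial G

{-# OPTIONS --safe #-}

-- Evaluated at k, the factor t^c(s) counts the colourings of the medial edges
-- that are constant on the curves of s.  After exchanging the two sums, the
-- inner sum over all states s compatible with a fixed colouring φ factorises
-- over the medial vertices.  The factor at a vertex is the sum of the weights
-- of the pairings that φ respects there: α + β + γ at a total vertex, one
-- weight at a vertex of white, black or crossing type, and 0 where the parity
-- condition fails, so that only k-valuations contribute.

module Submission where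

open import Algebra.Bundles using (CommutativeMonoid; CommutativeRing)
open import Data.Nat using (ℕ; NonZero)
open import Data.Product using (_,_)
open import Defs

import Algebra.Properties.CommutativeMonoid.Sum as CommutativeMonoidSum
import Algebra.Properties.CommutativeSemigroup as CommutativeSemigroupProperties
import Algebra.Properties.Semiring.Mult as SemiringMult
import Algebra.Solver.Ring.NaturalCoefficients.Default as RingSolver
open import Data.Bool using (if_then_else_; true; false)
open import Data.Fin using (Fin; zero; suc)
open import Data.Fin.Properties using (all?; any?; _≟_; ∀-cons-⇔; ¬∀⟶∃¬)
open import Data.List as List
  using (List; []; _∷_; _++_; length; filter; deduplicate; cartesianProductWith; tabulate; allFin)
open import Data.List.Properties using (length-tabulate; map-tabulate; filter-all)
open import Data.List.Relation.Unary.All as All using (All; []; _∷_)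
import Data.List.Relation.Unary.All.Properties as All
open import Data.List.Relation.Unary.AllPairs using (AllPairs; []; _∷_)
open import Data.List.Relation.Unary.Any using (Any; here; there)
import Data.List.Relation.Unary.Any.Properties as Any
import Data.List.Relation.Unary.Unique.DecSetoid.Properties as Unique
open import Data.Nat using (zero; suc)
open import Data.Nat.Divisibility using (_∣_; divides; _∣?_)
open import Data.Product using (∃; _×_; proj₂; uncurry)
open import Data.Vec as Vec using (Vec; []; _∷_; lookup)
open import Data.Vec.Properties using (lookup-map; lookup-replicate)
open import Function using (_∘_; _⇔_; mk⇔)
open import Function.Construct.Composition using (_⇔-∘_)
open import Function.Construct.Symmetry using (⇔-sym)
open import Level using (0ℓ)
open import Relation.Binary.Bundles using (DecSetoid)
import Relation.Binary.Construct.Closure.Equivalence as EqC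
import Relation.Binary.Construct.On as On
open import Relation.Binary.PropositionalEquality as ≡ using (_≡_; _≢_)
open import Relation.Nullary using (¬_; Dec; yes; no; does; ¬?; contradiction)
open import Relation.Nullary.Decidable using (dec-true; dec-false; does-⇔; from-no; _×-dec_; _→-dec_)
import Relation.Unary as U

-- Counting equivalence classes by deduplication.

module _ (S : DecSetoid 0ℓ 0ℓ) where
  open DecSetoid S using (Carrier; _≈_) renaming (_≟_ to _~?_; sym to ~-sym; trans to ~-trans)

  -- The entries are pairwise inequivalent, so the class of `x` has exactly one representative in
  -- `xs`, and the filter removes that one only.
  length-filter-≉ : ∀ {x xs} → AllPairs (λ y z → ¬ y ≈ z) xs → Any (x ≈_) xs →
    suc (length (filter (λ y → ¬? (x ~? y)) xs)) ≡ length xs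
  length-filter-≉ {x} {y ∷ ys} (y≉ys ∷ ys!) x∈y∷ys with x ~? y | x∈y∷ys
  ... | yes x≈y | _          = ≡.cong (suc ∘ length)
    (filter-all _ (All.map (λ y≉z x≈z → y≉z (~-trans (~-sym x≈y) x≈z)) y≉ys))
  ... | no x≉y  | here x≈y   = contradiction x≈y x≉y
  ... | no _    | there x∈ys = ≡.cong suc (length-filter-≉ ys! x∈ys)

  length-deduplicate-fresh : ∀ {x xs} → ¬ Any (x ≈_) xs →
    length (deduplicate _~?_ (x ∷ xs)) ≡ suc (length (deduplicate _~?_ xs))
  length-deduplicate-fresh x∉xs = ≡.cong (suc ∘ length)
    (filter-all _ (All.deduplicate⁺ _~?_ (All.¬Any⇒All¬ _ x∉xs)))

  -- The deduplicated tail still contains a representative of the class of `x`; putting `x` in front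
  -- displaces that single entry, so the length is unchanged.
  length-deduplicate-repeated : ∀ {x xs} → Any (x ≈_) xs →
    length (deduplicate _~?_ (x ∷ xs)) ≡ length (deduplicate _~?_ xs)
  length-deduplicate-repeated {x} {xs} x∈xs = length-filter-≉ (Unique.deduplicate-! S xs)
    (Any.deduplicate⁺ _~?_ (λ z≈y x≈y → ~-trans x≈y (~-sym z≈y)) x∈xs)

-- Colour patterns at a single medial vertex.

Coherent : ∀ {a} {A : Set a} → Vec A 4 → VertexState → Set a
Coherent cs x = All (λ { (p , q) → lookup cs p ≡ lookup cs q }) (pairing x)

module _ {k : ℕ} where

  multiplicity : Fin k → Vec (Fin k) 4 → ℕ
  multiplicity i = Vec.count (i ≟_)

  -- Once the two equalities are matched, two colours are left, each filling two places. Comparing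
  -- `i` with these two decides its multiplicity: 4, 2 or 0.
  coherent⇒even : ∀ (cs : Vec (Fin k) 4) x → Coherent cs x → ∀ i → 2 ∣ multiplicity i cs
  coherent⇒even (a ∷ _ ∷ c ∷ _ ∷ []) white (≡.refl ∷ ≡.refl ∷ []) i with does (i ≟ a) | does (i ≟ c)
  ... | true  | true  = divides 2 ≡.refl
  ... | true  | false = divides 1 ≡.refl
  ... | false | true  = divides 1 ≡.refl
  ... | false | false = divides 0 ≡.refl
  coherent⇒even (a ∷ b ∷ _ ∷ _ ∷ []) black (≡.refl ∷ ≡.refl ∷ []) i with does (i ≟ a) | does (i ≟ b)
  ... | true  | true  = divides 2 ≡.refl
  ... | true  | false = divides 1 ≡.refl
  ... | false | true  = divides 1 ≡.refl
  ... | false | false = divides 0 ≡.refl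
  coherent⇒even (a ∷ b ∷ _ ∷ _ ∷ []) crossing (≡.refl ∷ ≡.refl ∷ []) i with does (i ≟ a) | does (i ≟ b)
  ... | true  | true  = divides 2 ≡.refl
  ... | true  | false = divides 1 ≡.refl
  ... | false | true  = divides 1 ≡.refl
  ... | false | false = divides 0 ≡.refl

  -- By parity the first colour recurs. The place where it recurs selects the pairing, and the
  -- parity of another colour then forces the remaining two places to agree.
  even⇒coherent : ∀ (cs : Vec (Fin k) 4) → (∀ i → 2 ∣ multiplicity i cs) → ∃ (Coherent cs)
  even⇒coherent (a ∷ b ∷ c ∷ d ∷ []) even with a ≟ b | a ≟ c | a ≟ d
  ... | yes ≡.refl | _ | _ = white , ≡.refl ∷ c≡d ∷ []
    where
    c≡d : c ≡ d
    -- If `c` and `d` differed, `c` would occur three times or once in `a, a, c, d`, according to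
    -- whether it equals `a`. The equation from `dec-true` makes the comparison of `c` with itself
    -- compute. The next two cases run in the same way for `b`.
    c≡d with c ≟ d | does (c ≟ a) | does (c ≟ c) | dec-true (c ≟ c) ≡.refl | even c
    ... | yes eq | _     | _ | _      | _    = eq
    ... | no _   | true  | _ | ≡.refl | 2∣3 = contradiction 2∣3 (from-no (2 ∣? 3))
    ... | no _   | false | _ | ≡.refl | 2∣1 = contradiction 2∣1 (from-no (2 ∣? 1))
  ... | no _ | yes ≡.refl | _ = crossing , ≡.refl ∷ b≡d ∷ []
    where
    b≡d : b ≡ d
    b≡d with b ≟ d | does (b ≟ a) | does (b ≟ b) | dec-true (b ≟ b) ≡.refl | even b
    ... | yes eq | _     | _ | _      | _    = eq
    ... | no _   | true  | _ | ≡.refl | 2∣3 = contradiction 2∣3 (from-no (2 ∣? 3))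
    ... | no _   | false | _ | ≡.refl | 2∣1 = contradiction 2∣1 (from-no (2 ∣? 1))
  ... | no _ | no _ | yes ≡.refl = black , b≡c ∷ ≡.refl ∷ []
    where
    b≡c : b ≡ c
    b≡c with b ≟ c | does (b ≟ a) | does (b ≟ b) | dec-true (b ≟ b) ≡.refl | even b
    ... | yes eq | _     | _ | _      | _    = eq
    ... | no _   | true  | _ | ≡.refl | 2∣3 = contradiction 2∣3 (from-no (2 ∣? 3))
    ... | no _   | false | _ | ≡.refl | 2∣1 = contradiction 2∣1 (from-no (2 ∣? 1))
  -- Here `a` occurs exactly once, which is odd.
  ... | no a≢b | no a≢c | no a≢d with even a
  ... | 2∣m rewrite dec-true (a ≟ a) ≡.refl | dec-false (a ≟ b) a≢b | dec-false (a ≟ c) a≢c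
                  | dec-false (a ≟ d) a≢d = contradiction 2∣m (from-no (2 ∣? 1))

-- Two different perfect matchings of four points together form a 4-cycle, so equality spreads to
-- all four places. One pair of the second matching already links the two pairs of the first.
constant : ∀ {a} {A : Set a} (cs : Vec A 4) {x y} → x ≢ y → Coherent cs x → Coherent cs y →
  cs ≡ Vec.replicate 4 (Vec.head cs)
constant _ {white}    {white}    x≢x _ _ = contradiction ≡.refl x≢x
constant _ {black}    {black}    x≢x _ _ = contradiction ≡.refl x≢x
constant _ {crossing} {crossing} x≢x _ _ = contradiction ≡.refl x≢x
constant (_ ∷ _ ∷ _ ∷ _ ∷ []) {white}    {black}    _ (≡.refl ∷ ≡.refl ∷ []) (≡.refl ∷ _ ∷ []) = ≡.refl
constant (_ ∷ _ ∷ _ ∷ _ ∷ []) {white}    {crossing} _ (≡.refl ∷ ≡.refl ∷ []) (≡.refl ∷ _ ∷ []) = ≡.refl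
constant (_ ∷ _ ∷ _ ∷ _ ∷ []) {black}    {crossing} _ (≡.refl ∷ ≡.refl ∷ []) (≡.refl ∷ _ ∷ []) = ≡.refl
constant (_ ∷ _ ∷ _ ∷ _ ∷ []) {black}    {white}    _ (≡.refl ∷ ≡.refl ∷ []) (≡.refl ∷ _ ∷ []) = ≡.refl
constant (_ ∷ _ ∷ _ ∷ _ ∷ []) {crossing} {white}    _ (≡.refl ∷ ≡.refl ∷ []) (≡.refl ∷ _ ∷ []) = ≡.refl
constant (_ ∷ _ ∷ _ ∷ _ ∷ []) {crossing} {black}    _ (≡.refl ∷ ≡.refl ∷ []) (≡.refl ∷ _ ∷ []) = ≡.refl

-- Colourings that are constant on equivalence classes.

module _ (S : DecSetoid 0ℓ 0ℓ) where
  open DecSetoid S using (Carrier; _≈_) renaming (_≟_ to _~?_; sym to ~-sym; trans to ~-trans)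

  -- Indexing the elements through `ι` lets an induction drop the first position by passing to
  -- `ι ∘ suc` while the setoid stays fixed.
  Invariant : ∀ {n k} → (Fin n → Carrier) → Vec (Fin k) n → Set
  Invariant ι φ = ∀ i j → ι i ≈ ι j → lookup φ i ≡ lookup φ j

  invariant? : ∀ {n k} (ι : Fin n → Carrier) → U.Decidable (Invariant {k = k} ι)
  invariant? ι φ = all? λ i → all? λ j → (ι i ~? ι j) →-dec (lookup φ i ≟ lookup φ j)

  invariant-fresh : ∀ {n k} (ι : Fin (suc n) → Carrier) → ¬ (∃ λ j → ι zero ≈ ι (suc j)) →
    ∀ (x : Fin k) φ → Invariant ι (x ∷ φ) ⇔ Invariant (ι ∘ suc) φ
  invariant-fresh {n} {k} ι fresh x φ = mk⇔ (λ inv i j → inv (suc i) (suc j)) from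
    where
    from : Invariant (ι ∘ suc) φ → Invariant ι (x ∷ φ)
    from inv zero    zero    _ = ≡.refl
    from inv zero    (suc j) r = contradiction (j , r) fresh
    from inv (suc i) zero    r = contradiction (i , ~-sym r) fresh
    from inv (suc i) (suc j) r = inv i j r

  invariant-repeated : ∀ {n k} (ι : Fin (suc n) → Carrier) {i} → ι zero ≈ ι (suc i) →
    ∀ (x : Fin k) φ → Invariant ι (x ∷ φ) ⇔ (x ≡ lookup φ i × Invariant (ι ∘ suc) φ)
  invariant-repeated {n} {k} ι {i} r₀ x φ =
    mk⇔ (λ inv → inv zero (suc i) r₀ , λ i j → inv (suc i) (suc j)) (uncurry from)
    where
    from : x ≡ lookup φ i → Invariant (ι ∘ suc) φ → Invariant ι (x ∷ φ)
    from x≡ inv zero    zero    _ = ≡.refl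
    from x≡ inv zero    (suc j) r = ≡.trans x≡ (inv i j (~-trans (~-sym r₀) r))
    from x≡ inv (suc j) zero    r = ≡.trans (inv j i (~-trans r r₀)) (≡.sym x≡)
    from x≡ inv (suc i) (suc j) r = inv i j r

generated : ∀ {n} → List (Fin n × Fin n) → DecSetoid 0ℓ 0ℓ
generated ps = record
  { Carrier          = Fin _
  ; _≈_              = Generated ps
  ; isDecEquivalence = record { isEquivalence = EqC.isEquivalence _ ; _≟_ = generated? ps }
  }

-- Having equal colours is itself an equivalence relation, so it contains the generated one as soon
-- as it contains the generating pairs.
invariant⇔respects : ∀ {n k} ps (φ : Vec (Fin k) n) →
  Invariant (generated ps) (λ i → i) φ ⇔ All (λ { (i , j) → lookup φ i ≡ lookup φ j }) ps
invariant⇔respects ps φ = mk⇔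
  (λ inv → All.tabulate (λ p∈ps → inv _ _ (EqC.return p∈ps)))
  (λ resp i j → EqC.fold (On.isEquivalence (lookup φ) ≡.isEquivalence) (All.lookup resp))

-- From curves of a state to conditions at the medial vertices.

module _ (G : EmbeddedGraph) where
  open Medial G hiding (𝒦; tot; wh; bl; cr)

  -- This turns a global condition on curves into a conjunction over medial vertices, which is what
  -- makes the sum over states factorise.
  respects-joins⇔coherent : ∀ {k} s (φ : Colouring {k}) →
    All (λ { (i , j) → lookup φ i ≡ lookup φ j }) (joins s) ⇔
      (∀ v → Coherent (colours φ v) (lookup s v))
  respects-joins⇔coherent s φ = mk⇔
    (λ resp v → All.map (λ {pq} → to v pq) (All.map⁻ (All.tabulate⁻ (All.map⁻ (All.concat⁻ resp)) v)))
    (λ coh → All.concat⁺ (All.map⁺ (All.tabulate⁺ λ v → All.map⁺ (All.map (λ {pq} → from v pq) (coh v)))))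
    where
    to : ∀ v ((p , q) : Fin 4 × Fin 4) → lookup φ (edgeAt v p) ≡ lookup φ (edgeAt v q) →
         lookup (colours φ v) p ≡ lookup (colours φ v) q
    to v (p , q) eq = ≡.trans (lookup-map p (lookup φ) (halfEdges v))
      (≡.trans eq (≡.sym (lookup-map q (lookup φ) (halfEdges v))))
    from : ∀ v ((p , q) : Fin 4 × Fin 4) → lookup (colours φ v) p ≡ lookup (colours φ v) q →
         lookup φ (edgeAt v p) ≡ lookup φ (edgeAt v q)
    from v (p , q) eq = ≡.trans (≡.sym (lookup-map p (lookup φ) (halfEdges v)))
      (≡.trans eq (lookup-map q (lookup φ) (halfEdges v)))

-- Finite sums and products in a commutative ring.

module Expansion {r ℓ} (R : CommutativeRing r ℓ) where
  open CommutativeRing R hiding (zero)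
  open Transition R
  open CommutativeMonoidSum *-commutativeMonoid using ()
    renaming (sum to ∏; sum-cong-≋ to ∏-cong; ∑-distrib-+ to ∏-distrib-*)
  open CommutativeSemigroupProperties (CommutativeMonoid.commutativeSemigroup +-commutativeMonoid)
    using () renaming (interchange to +-interchange)
  open SemiringMult semiring using (×-assoc-*; ×-congʳ) renaming (_×_ to _·_)
  open RingSolver commutativeSemiring using (solve; con; _:+_; _:*_; _:=_)
  open import Relation.Binary.Reasoning.Setoid setoid

  ∑-cong : ∀ {a} {A : Set a} xs {f g : A → Carrier} → (∀ x → f x ≈ g x) → sumOver xs f ≈ sumOver xs g
  ∑-cong []       f≈g = refl
  ∑-cong (x ∷ xs) f≈g = +-cong (f≈g x) (∑-cong xs f≈g)

  ∑-zero : ∀ {a} {A : Set a} (xs : List A) → ∑[ _ ∈ xs ] 0# ≈ 0#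
  ∑-zero []       = refl
  ∑-zero (_ ∷ xs) = trans (+-identityˡ _) (∑-zero xs)

  ∑-distrib-+ : ∀ {a} {A : Set a} xs (f g : A → Carrier) →
    ∑[ x ∈ xs ] (f x + g x) ≈ sumOver xs f + sumOver xs g
  ∑-distrib-+ []       f g = sym (+-identityˡ 0#)
  ∑-distrib-+ (x ∷ xs) f g = trans (+-congˡ (∑-distrib-+ xs f g)) (+-interchange _ _ _ _)

  *-distribˡ-∑ : ∀ {a} {A : Set a} y xs (f : A → Carrier) → y * sumOver xs f ≈ ∑[ x ∈ xs ] (y * f x)
  *-distribˡ-∑ y []       f = zeroʳ y
  *-distribˡ-∑ y (x ∷ xs) f = trans (distribˡ _ _ _) (+-congˡ (*-distribˡ-∑ y xs f))

  *-distribʳ-∑ : ∀ {a} {A : Set a} y xs (f : A → Carrier) → sumOver xs f * y ≈ ∑[ x ∈ xs ] (f x * y)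
  *-distribʳ-∑ y []       f = zeroˡ y
  *-distribʳ-∑ y (x ∷ xs) f = trans (distribʳ _ _ _) (+-congˡ (*-distribʳ-∑ y xs f))

  ∑-const : ∀ {a} {A : Set a} (xs : List A) y → ∑[ _ ∈ xs ] y ≈ length xs · y
  ∑-const []       y = refl
  ∑-const (_ ∷ xs) y = +-congˡ (∑-const xs y)

  ∑-comm : ∀ {a b} {A : Set a} {B : Set b} xs ys (f : A → B → Carrier) →
    ∑[ x ∈ xs ] (∑[ y ∈ ys ] f x y) ≈ ∑[ y ∈ ys ] (∑[ x ∈ xs ] f x y)
  ∑-comm []       ys f = sym (∑-zero ys)
  ∑-comm (x ∷ xs) ys f = trans (+-congˡ (∑-comm xs ys f)) (sym (∑-distrib-+ ys (f x) _))

  ∑-++ : ∀ {a} {A : Set a} xs ys (f : A → Carrier) → sumOver (xs ++ ys) f ≈ sumOver xs f + sumOver ys f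
  ∑-++ []       ys f = sym (+-identityˡ _)
  ∑-++ (x ∷ xs) ys f = trans (+-congˡ (∑-++ xs ys f)) (sym (+-assoc _ _ _))

  ∑-map : ∀ {a b} {A : Set a} {B : Set b} (h : A → B) xs (f : B → Carrier) →
    sumOver (List.map h xs) f ≈ ∑[ x ∈ xs ] f (h x)
  ∑-map h []       f = refl
  ∑-map h (x ∷ xs) f = +-congˡ (∑-map h xs f)

  ∑-tabulate : ∀ {a} {A : Set a} {n} (h : Fin n → A) (f : A → Carrier) →
    sumOver (tabulate h) f ≈ ∑[ i ∈ allFin n ] f (h i)
  ∑-tabulate h f = trans (reflexive (≡.cong (λ xs → sumOver xs f) (≡.sym (map-tabulate (λ i → i) h))))
    (∑-map h (allFin _) f)

  ∑-cartesianProductWith : ∀ {a b c} {A : Set a} {B : Set b} {C : Set c} (h : A → B → C) xs ys f →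
    sumOver (cartesianProductWith h xs ys) f ≈ ∑[ x ∈ xs ] (∑[ y ∈ ys ] f (h x y))
  ∑-cartesianProductWith h []       ys f = refl
  ∑-cartesianProductWith h (x ∷ xs) ys f = trans (∑-++ (List.map (h x) ys) _ f)
    (+-cong (∑-map (h x) ys f) (∑-cartesianProductWith h xs ys f))

  ∑-filter : ∀ {a p} {A : Set a} {P : U.Pred A p} (P? : U.Decidable P) xs {f g : A → Carrier} →
    (∀ x → P x → f x ≈ g x) → (∀ x → ¬ P x → f x ≈ 0#) → sumOver xs f ≈ sumOver (filter P? xs) g
  ∑-filter P? []       f≈g f≈0 = refl
  ∑-filter P? (x ∷ xs) f≈g f≈0 with P? x
  ... | yes Px = +-cong (f≈g x Px) (∑-filter P? xs f≈g f≈0)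
  ... | no ¬Px = trans (+-cong (f≈0 x ¬Px) (∑-filter P? xs f≈g f≈0)) (+-identityˡ _)

  ∏-zero : ∀ {n} (f : Fin n → Carrier) i → f i ≈ 0# → ∏ f ≈ 0#
  ∏-zero f zero    fᵢ≈0 = trans (*-congʳ fᵢ≈0) (zeroˡ _)
  ∏-zero f (suc i) fᵢ≈0 = trans (*-congˡ (∏-zero (f ∘ suc) i fᵢ≈0)) (zeroʳ _)

  -- The general distributive law: expanding a product of sums means choosing one summand in each
  -- factor, and such a choice is a word.
  ∑-words : ∀ {a} {A : Set a} (xs : List A) {n} (f : Fin n → A → Carrier) →
    ∑[ w ∈ words xs n ] ∏ (λ i → f i (lookup w i)) ≈ ∏ (λ i → ∑[ x ∈ xs ] f i x)
  ∑-words xs {zero}  f = +-identityʳ 1#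
  ∑-words xs {suc n} f = begin
    ∑[ w ∈ words xs (suc n) ] ∏ (λ i → f i (lookup w i))
      ≈⟨ ∑-cartesianProductWith _∷_ xs (words xs n) _ ⟩
    ∑[ x ∈ xs ] (∑[ w ∈ words xs n ] (f zero x * ∏ (λ i → f (suc i) (lookup w i))))
      ≈⟨ ∑-cong xs (λ x → *-distribˡ-∑ (f zero x) (words xs n) _) ⟨
    ∑[ x ∈ xs ] (f zero x * (∑[ w ∈ words xs n ] ∏ (λ i → f (suc i) (lookup w i))))
      ≈⟨ *-distribʳ-∑ _ xs (f zero) ⟨
    (∑[ x ∈ xs ] f zero x) * (∑[ w ∈ words xs n ] ∏ (λ i → f (suc i) (lookup w i)))
      ≈⟨ *-congˡ (∑-words xs (f ∘ suc)) ⟩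
    ∏ (λ i → ∑[ x ∈ xs ] f i x) ∎

  -- Iverson brackets with values in the ring.

  ⟦_⟧ : ∀ {p} {P : Set p} → Dec P → Carrier
  ⟦ P? ⟧ = if does P? then 1# else 0#

  ⟦⟧-cong : ∀ {p q} {P : Set p} {Q : Set q} (P? : Dec P) (Q? : Dec Q) → P ⇔ Q → ⟦ P? ⟧ ≈ ⟦ Q? ⟧
  ⟦⟧-cong P? Q? P⇔Q = reflexive (≡.cong (if_then 1# else 0#) (does-⇔ P⇔Q P? Q?))

  ⟦⟧-true : ∀ {p} {P : Set p} (P? : Dec P) → P → ⟦ P? ⟧ ≈ 1#
  ⟦⟧-true P? p = reflexive (≡.cong (if_then 1# else 0#) (dec-true P? p))

  ⟦⟧-false : ∀ {p} {P : Set p} (P? : Dec P) → ¬ P → ⟦ P? ⟧ ≈ 0#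
  ⟦⟧-false P? ¬p = reflexive (≡.cong (if_then 1# else 0#) (dec-false P? ¬p))

  ⟦⟧-× : ∀ {p q} {P : Set p} {Q : Set q} (P? : Dec P) (Q? : Dec Q) → ⟦ P? ×-dec Q? ⟧ ≈ ⟦ P? ⟧ * ⟦ Q? ⟧
  ⟦⟧-× P? Q? with does P?
  ... | true  = sym (*-identityˡ _)
  ... | false = sym (zeroˡ _)

  ⟦⟧-∀ : ∀ {n p} {P : U.Pred (Fin n) p} (P? : U.Decidable P) → ⟦ all? P? ⟧ ≈ ∏ (λ i → ⟦ P? i ⟧)
  ⟦⟧-∀ {zero}  P? = ⟦⟧-true (all? P?) λ ()
  ⟦⟧-∀ {suc n} P? = begin
    ⟦ all? P? ⟧
      ≈⟨ ⟦⟧-cong (all? P?) (P? zero ×-dec all? (P? ∘ suc)) (⇔-sym ∀-cons-⇔) ⟩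
    ⟦ P? zero ×-dec all? (P? ∘ suc) ⟧    ≈⟨ ⟦⟧-× (P? zero) (all? (P? ∘ suc)) ⟩
    ⟦ P? zero ⟧ * ⟦ all? (P? ∘ suc) ⟧    ≈⟨ *-congˡ (⟦⟧-∀ (P? ∘ suc)) ⟩
    ∏ (λ i → ⟦ P? i ⟧)                   ∎

  ∑-⟦≟⟧ : ∀ {n} (j : Fin n) → ∑[ i ∈ allFin n ] ⟦ i ≟ j ⟧ ≈ 1#
  ∑-⟦≟⟧ {suc n} zero    = trans
    (+-congˡ (trans (∑-tabulate suc (λ i → ⟦ i ≟ zero {n} ⟧)) (∑-zero (allFin n))))
    (+-identityʳ 1#)
  ∑-⟦≟⟧ {suc n} (suc j) = trans (+-identityˡ _)
    (trans (∑-tabulate suc (λ i → ⟦ i ≟ suc j ⟧)) (∑-⟦≟⟧ j))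

  -- Powers of `k` as numbers of invariant colourings.

  module _ (S : DecSetoid 0ℓ 0ℓ) where
    open DecSetoid S using () renaming (Carrier to A; _≟_ to _~?_)

    -- Induction on the positions: if the class of the first position does not occur later, its
    -- colour is free and contributes a factor `k`; otherwise its colour is forced by a later
    -- position and contributes a factor 1.
    count-invariant : ∀ k {n} (ι : Fin n → A) →
      ∑[ φ ∈ words (allFin k) n ] ⟦ invariant? S ι φ ⟧ ≈
        fromℕ k ^ length (deduplicate _~?_ (tabulate ι))
    count-invariant k {zero}  ι = trans (+-identityʳ _) (⟦⟧-true (invariant? S {k = k} ι []) λ ())
    count-invariant k {suc n} ι with any? (λ j → ι zero ~? ι (suc j))
    ... | no fresh = begin
      ∑[ φ ∈ words (allFin k) (suc n) ] ⟦ invariant? S ι φ ⟧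
        ≈⟨ ∑-cartesianProductWith _∷_ (allFin k) (words (allFin k) n) _ ⟩
      ∑[ x ∈ allFin k ] (∑[ φ ∈ words (allFin k) n ] ⟦ invariant? S ι (x ∷ φ) ⟧)
        ≈⟨ ∑-cong (allFin k) (λ x → ∑-cong (words (allFin k) n) λ φ →
             ⟦⟧-cong (invariant? S ι (x ∷ φ)) (invariant? S (ι ∘ suc) φ) (invariant-fresh S ι fresh x φ)) ⟩
      ∑[ _ ∈ allFin k ] (∑[ φ ∈ words (allFin k) n ] ⟦ invariant? S (ι ∘ suc) φ ⟧)
        ≈⟨ ∑-const (allFin k) _ ⟩
      length (allFin k) · (∑[ φ ∈ words (allFin k) n ] ⟦ invariant? S (ι ∘ suc) φ ⟧)
        ≡⟨ ≡.cong (_· (∑[ φ ∈ words (allFin k) n ] ⟦ invariant? S (ι ∘ suc) φ ⟧))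
             (length-tabulate {n = k} (λ i → i)) ⟩
      k · (∑[ φ ∈ words (allFin k) n ] ⟦ invariant? S (ι ∘ suc) φ ⟧)
        ≈⟨ fromℕ-* k _ ⟨
      fromℕ k * (∑[ φ ∈ words (allFin k) n ] ⟦ invariant? S (ι ∘ suc) φ ⟧)
        ≈⟨ *-congˡ (count-invariant k (ι ∘ suc)) ⟩
      fromℕ k ^ suc (length (deduplicate _~?_ (tabulate (ι ∘ suc))))
        ≡⟨ ≡.cong (fromℕ k ^_) (length-deduplicate-fresh S (fresh ∘ Any.tabulate⁻)) ⟨
      fromℕ k ^ length (deduplicate _~?_ (tabulate ι)) ∎
      where
      fromℕ-* : ∀ m y → fromℕ m * y ≈ m · y
      fromℕ-* m y = trans (×-assoc-* m 1# y) (×-congʳ m (*-identityˡ y))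
    ... | yes (j , r) = begin
      ∑[ φ ∈ words (allFin k) (suc n) ] ⟦ invariant? S ι φ ⟧
        ≈⟨ ∑-cartesianProductWith _∷_ (allFin k) (words (allFin k) n) _ ⟩
      ∑[ x ∈ allFin k ] (∑[ φ ∈ words (allFin k) n ] ⟦ invariant? S ι (x ∷ φ) ⟧)
        ≈⟨ ∑-cong (allFin k) (λ x → ∑-cong (words (allFin k) n) λ φ → trans
             (⟦⟧-cong (invariant? S ι (x ∷ φ)) ((x ≟ lookup φ j) ×-dec invariant? S (ι ∘ suc) φ)
               (invariant-repeated S ι r x φ))
             (⟦⟧-× (x ≟ lookup φ j) (invariant? S (ι ∘ suc) φ))) ⟩
      ∑[ x ∈ allFin k ] (∑[ φ ∈ words (allFin k) n ] (⟦ x ≟ lookup φ j ⟧ * ⟦ invariant? S (ι ∘ suc) φ ⟧))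
        ≈⟨ ∑-comm (allFin k) (words (allFin k) n) _ ⟩
      ∑[ φ ∈ words (allFin k) n ] (∑[ x ∈ allFin k ] (⟦ x ≟ lookup φ j ⟧ * ⟦ invariant? S (ι ∘ suc) φ ⟧))
        -- Exactly one colour `x` equals the forced colour `lookup φ j`, so the inner sum of
        -- brackets is 1.
        ≈⟨ ∑-cong (words (allFin k) n) (λ φ → trans
             (sym (*-distribʳ-∑ ⟦ invariant? S (ι ∘ suc) φ ⟧ (allFin k) (λ x → ⟦ x ≟ lookup φ j ⟧)))
             (trans (*-congʳ (∑-⟦≟⟧ (lookup φ j))) (*-identityˡ _))) ⟩
      ∑[ φ ∈ words (allFin k) n ] ⟦ invariant? S (ι ∘ suc) φ ⟧
        ≈⟨ count-invariant k (ι ∘ suc) ⟩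
      fromℕ k ^ length (deduplicate _~?_ (tabulate (ι ∘ suc)))
        ≡⟨ ≡.cong (fromℕ k ^_) (length-deduplicate-repeated S (Any.tabulate⁺ j r)) ⟨
      fromℕ k ^ length (deduplicate _~?_ (tabulate ι)) ∎

  -- Powers as products of conditional factors.

  _if_ : ∀ {p} {P : Set p} → Carrier → Dec P → Carrier
  x if P? = if does P? then x else 1#

  if-true : ∀ {p} {P : Set p} x (P? : Dec P) → P → x if P? ≈ x
  if-true x P? p = reflexive (≡.cong (if_then x else 1#) (dec-true P? p))

  if-false : ∀ {p} {P : Set p} x (P? : Dec P) → ¬ P → x if P? ≈ 1#
  if-false x P? ¬p = reflexive (≡.cong (if_then x else 1#) (dec-false P? ¬p))

  -- Positions where `P?` fails contribute the default `1#`, so the exponent counts the others. For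
  -- the identity `ι` it is the count `# P?`; a general `ι` is what the induction needs.
  ∏-if : ∀ {m n p} {P : U.Pred (Fin m) p} (P? : U.Decidable P) x (ι : Fin n → Fin m) →
    ∏ (λ i → x if P? (ι i)) ≈ x ^ length (filter P? (tabulate ι))
  ∏-if {n = zero}  P? x ι = refl
  ∏-if {n = suc n} P? x ι with does (P? (ι zero))
  ... | true  = *-congˡ (∏-if P? x (ι ∘ suc))
  ... | false = trans (*-identityˡ _) (∏-if P? x (ι ∘ suc))

  -- The contribution of one medial vertex.

  module _ (α β γ : Carrier) where

    states : List VertexState
    states = white ∷ black ∷ crossing ∷ []

    ω-∏ : ∀ {n} (s : Vec VertexState n) → ω α β γ s ≈ ∏ (λ i → weight α β γ (lookup s i))
    ω-∏ []      = refl
    ω-∏ (x ∷ s) = *-congˡ (ω-∏ s)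

    coherent? : ∀ {k} (cs : Vec (Fin k) 4) → U.Decidable (Coherent cs)
    coherent? cs x = All.all? (λ { (p , q) → lookup cs p ≟ lookup cs q }) (pairing x)

    localWeight : ∀ {k} → Vec (Fin k) 4 → Carrier
    localWeight cs = ∑[ x ∈ states ] (weight α β γ x * ⟦ coherent? cs x ⟧)

    localWeight-cong : ∀ {k} (cs : Vec (Fin k) 4) {a b c} → ⟦ coherent? cs white ⟧ ≈ a →
      ⟦ coherent? cs black ⟧ ≈ b → ⟦ coherent? cs crossing ⟧ ≈ c →
      localWeight cs ≈ α * a + (β * b + (γ * c + 0#))
    localWeight-cong cs a b c = +-cong (*-congˡ a) (+-cong (*-congˡ b) (+-congʳ (*-congˡ c)))

    localWeight-incoherent : ∀ {k} (cs : Vec (Fin k) 4) → ¬ ∃ (Coherent cs) → localWeight cs ≈ 0#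
    localWeight-incoherent cs ¬coh = trans
      (∑-cong states λ x → trans (*-congˡ {weight α β γ x} (⟦⟧-false (coherent? cs x) (¬coh ∘ (x ,_)))) (zeroʳ _))
      (∑-zero states)

    module _ (G : EmbeddedGraph) where
      open Medial G hiding (𝒦; tot; wh; bl; cr)

      -- A product of four conditional factors takes the place of a case distinction on the type of
      -- `v`, so that the product over all vertices splits into the four powers.
      localFactor : ∀ {k} → Colouring {k} → Fin Vₘ → Carrier
      localFactor φ v = ((α + β + γ) if total? φ v) * (α if ofType? white φ v)
        * (β if ofType? black φ v) * (γ if ofType? crossing φ v)

      ∏-localFactor : ∀ {k} (φ : Colouring {k}) → ∏ (localFactor φ) ≈
        (α + β + γ) ^ tot G φ * α ^ wh G φ * β ^ bl G φ * γ ^ cr G φ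
      ∏-localFactor φ = trans (∏-distrib-* {Vₘ} _ _) (*-cong
        (trans (∏-distrib-* {Vₘ} _ _) (*-cong
          (trans (∏-distrib-* {Vₘ} _ _) (*-cong
            (∏-if (total? φ) _ (λ v → v))
            (∏-if (ofType? white φ) _ (λ v → v))))
          (∏-if (ofType? black φ) _ (λ v → v))))
        (∏-if (ofType? crossing φ) _ (λ v → v)))

      localFactor-cong : ∀ {k} (φ : Colouring {k}) v {t a b c} →
        (α + β + γ) if total? φ v ≈ t → α if ofType? white φ v ≈ a →
        β if ofType? black φ v ≈ b → γ if ofType? crossing φ v ≈ c →
        localFactor φ v ≈ t * a * b * c
      localFactor-cong φ v t a b c = *-cong (*-cong (*-cong t a) b) c

      -- Four equal colours respect every pairing, so all three brackets are 1 and the weights add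
      -- up.
      localWeight-total : ∀ {k} (φ : Colouring {k}) v → Total φ v →
        localWeight (colours φ v) ≈ localFactor φ v
      localWeight-total φ v total = begin
        localWeight (colours φ v)
          ≈⟨ localWeight-cong (colours φ v) (holds white) (holds black) (holds crossing) ⟩
        α * 1# + (β * 1# + (γ * 1# + 0#))
          ≈⟨ solve 3 (λ a b c → a :* con 1 :+ (b :* con 1 :+ (c :* con 1 :+ con 0))
               := (a :+ b :+ c) :* con 1 :* con 1 :* con 1) refl α β γ ⟩
        (α + β + γ) * 1# * 1# * 1#
          ≈⟨ localFactor-cong φ v (if-true _ (total? φ v) total)
               (skips α white) (skips β black) (skips γ crossing) ⟨
        localFactor φ v ∎
        where
        holds : ∀ y → ⟦ coherent? (colours φ v) y ⟧ ≈ 1#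
        holds y = ⟦⟧-true (coherent? (colours φ v) y) (All.universal (λ { (p , q) → total p q }) (pairing y))
        skips : ∀ z y → z if ofType? y φ v ≈ 1#
        skips z y = if-false z (ofType? y φ v) (λ { (¬total , _) → ¬total total })

      -- By `constant`, a second coherent state would make the vertex total. Hence only the bracket
      -- of `x` survives on the left, and only the factor of type `x` on the right.
      localWeight-nontotal : ∀ {k} (φ : Colouring {k}) v → ¬ Total φ v →
        ∀ x → Coherent (colours φ v) x → localWeight (colours φ v) ≈ localFactor φ v
      localWeight-nontotal φ v ¬total = λ where
          white cx → begin
            localWeight (colours φ v)
              ≈⟨ localWeight-cong (colours φ v)
                   (holds white cx)
                   (fails white cx black λ ())
                   (fails white cx crossing λ ()) ⟩
            α * 1# + (β * 0# + (γ * 0# + 0#))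
              ≈⟨ solve 3 (λ a b c → a :* con 1 :+ (b :* con 0 :+ (c :* con 0 :+ con 0))
                   := con 1 :* a :* con 1 :* con 1) refl α β γ ⟩
            1# * α * 1# * 1#
              ≈⟨ localFactor-cong φ v not-total
                   (takes α white cx)
                   (skips β white cx black λ ())
                   (skips γ white cx crossing λ ()) ⟨
            localFactor φ v ∎
          black cx → begin
            localWeight (colours φ v)
              ≈⟨ localWeight-cong (colours φ v)
                   (fails black cx white λ ())
                   (holds black cx)
                   (fails black cx crossing λ ()) ⟩
            α * 0# + (β * 1# + (γ * 0# + 0#))
              ≈⟨ solve 3 (λ a b c → a :* con 0 :+ (b :* con 1 :+ (c :* con 0 :+ con 0))
                   := con 1 :* con 1 :* b :* con 1) refl α β γ ⟩
            1# * 1# * β * 1#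
              ≈⟨ localFactor-cong φ v not-total
                   (skips α black cx white λ ())
                   (takes β black cx)
                   (skips γ black cx crossing λ ()) ⟨
            localFactor φ v ∎
          crossing cx → begin
            localWeight (colours φ v)
              ≈⟨ localWeight-cong (colours φ v)
                   (fails crossing cx white λ ())
                   (fails crossing cx black λ ())
                   (holds crossing cx) ⟩
            α * 0# + (β * 0# + (γ * 1# + 0#))
              ≈⟨ solve 3 (λ a b c → a :* con 0 :+ (b :* con 0 :+ (c :* con 1 :+ con 0))
                   := con 1 :* con 1 :* con 1 :* c) refl α β γ ⟩
            1# * 1# * 1# * γ
              ≈⟨ localFactor-cong φ v not-total
                   (skips α crossing cx white λ ())
                   (skips β crossing cx black λ ())
                   (takes γ crossing cx) ⟨
            localFactor φ v ∎
        where
        not-total : (α + β + γ) if total? φ v ≈ 1#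
        not-total = if-false _ (total? φ v) ¬total
        excluded : ∀ {x} → Coherent (colours φ v) x → ∀ {y} → x ≢ y → ¬ Coherent (colours φ v) y
        excluded cx x≢y cy = ¬total λ p q → ≡.trans (constantly p) (≡.sym (constantly q))
          where
          constantly : ∀ p → lookup (colours φ v) p ≡ Vec.head (colours φ v)
          constantly p = ≡.trans (≡.cong (λ cs → lookup cs p) (constant (colours φ v) x≢y cx cy))
            (lookup-replicate p _)
        holds : ∀ x → Coherent (colours φ v) x → ⟦ coherent? (colours φ v) x ⟧ ≈ 1#
        holds x cx = ⟦⟧-true (coherent? (colours φ v) x) cx
        fails : ∀ x → Coherent (colours φ v) x → ∀ y → x ≢ y → ⟦ coherent? (colours φ v) y ⟧ ≈ 0#
        fails x cx y x≢y = ⟦⟧-false (coherent? (colours φ v) y) (excluded cx x≢y)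
        takes : ∀ z x → Coherent (colours φ v) x → z if ofType? x φ v ≈ z
        -- `OfType x φ v` unfolds to non-totality together with coherence of the four colours with
        -- `x`.
        takes z x cx = if-true z (ofType? x φ v) (¬total , cx)
        skips : ∀ z x → Coherent (colours φ v) x → ∀ y → x ≢ y → z if ofType? y φ v ≈ 1#
        skips z x cx y x≢y = if-false z (ofType? y φ v) (excluded cx x≢y ∘ proj₂)

      localWeight≈localFactor : ∀ {k} (φ : Colouring {k}) v → ∃ (Coherent (colours φ v)) →
        localWeight (colours φ v) ≈ localFactor φ v
      localWeight≈localFactor φ v (x , cx) with total? φ v
      ... | yes total = localWeight-total φ v total
      ... | no ¬total = localWeight-nontotal φ v ¬total x cx

      ∏-localWeight-valuation : ∀ {k} (φ : Colouring {k}) → IsValuation φ →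
        ∏ (λ v → localWeight (colours φ v)) ≈
          (α + β + γ) ^ tot G φ * α ^ wh G φ * β ^ bl G φ * γ ^ cr G φ
      ∏-localWeight-valuation φ val = trans
        (∏-cong {Vₘ} λ v → localWeight≈localFactor φ v (even⇒coherent (colours φ v) λ i → val i v))
        (∏-localFactor φ)

      -- Where parity fails for some colour, `coherent⇒even` rules out every vertex state, and this
      -- one vanishing factor kills the product.
      ∏-localWeight-nonvaluation : ∀ {k} (φ : Colouring {k}) → ¬ IsValuation φ →
        ∏ (λ v → localWeight (colours φ v)) ≈ 0#
      ∏-localWeight-nonvaluation φ ¬val =
        let i , ¬even  = ¬∀⟶∃¬ _ _ (λ i → all? λ v → 2 ∣? multiplicity i (colours φ v)) ¬val
            v , ¬evenᵥ = ¬∀⟶∃¬ _ _ (λ v → 2 ∣? multiplicity i (colours φ v)) ¬even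
        in ∏-zero (λ v → localWeight (colours φ v)) v
             (localWeight-incoherent (colours φ v)
               λ { (x , coh) → ¬evenᵥ (coherent⇒even (colours φ v) x coh i) })

      -- Double counting of states and colourings.

      curves : GraphState → DecSetoid 0ℓ 0ℓ
      curves s = generated (joins s)

      constantOnCurves? : ∀ {k} s → U.Decidable (Invariant (curves s) {k = k} (λ i → i))
      constantOnCurves? s = invariant? (curves s) (λ i → i)

      -- Both the weight of `s` and the bracket for constancy on its curves are products over the
      -- medial vertices, so they combine vertex by vertex.
      ω-constantOnCurves : ∀ {k} s (φ : Colouring {k}) → ω α β γ s * ⟦ constantOnCurves? s φ ⟧ ≈
        ∏ (λ v → weight α β γ (lookup s v) * ⟦ coherent? (colours φ v) (lookup s v) ⟧)
      ω-constantOnCurves s φ = begin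
        ω α β γ s * ⟦ constantOnCurves? s φ ⟧
          ≈⟨ *-cong (ω-∏ s) (⟦⟧-cong (constantOnCurves? s φ) (all? λ v → coherent? (colours φ v) (lookup s v))
               (respects-joins⇔coherent G s φ ⇔-∘ invariant⇔respects (joins s) φ)) ⟩
        ∏ (λ v → weight α β γ (lookup s v)) * ⟦ all? (λ v → coherent? (colours φ v) (lookup s v)) ⟧
          ≈⟨ *-congˡ (⟦⟧-∀ λ v → coherent? (colours φ v) (lookup s v)) ⟩
        ∏ (λ v → weight α β γ (lookup s v)) * ∏ (λ v → ⟦ coherent? (colours φ v) (lookup s v) ⟧)
          ≈⟨ ∏-distrib-* {Vₘ} _ _ ⟨
        ∏ (λ v → weight α β γ (lookup s v) * ⟦ coherent? (colours φ v) (lookup s v) ⟧) ∎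

      expansion : ∀ k → Q G (α , β , γ) (fromℕ k) ≈
        ∑[ φ ∈ 𝒦 G k ] ((α + β + γ) ^ tot G φ * α ^ wh G φ * β ^ bl G φ * γ ^ cr G φ)
      expansion k = begin
        ∑[ s ∈ graphStates ] (ω α β γ s * fromℕ k ^ c s)
          -- With the identity as `ι`, the deduplicated list is that of all medial edges, free loops
          -- included, so the exponent is `c s`.
          ≈⟨ ∑-cong graphStates (λ s → *-congˡ (count-invariant (curves s) k (λ i → i))) ⟨
        ∑[ s ∈ graphStates ] (ω α β γ s * (∑[ φ ∈ colourings ] ⟦ constantOnCurves? s φ ⟧))
          ≈⟨ ∑-cong graphStates (λ s → *-distribˡ-∑ (ω α β γ s) colourings _) ⟩
        ∑[ s ∈ graphStates ] (∑[ φ ∈ colourings ] (ω α β γ s * ⟦ constantOnCurves? s φ ⟧))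
          ≈⟨ ∑-comm graphStates colourings _ ⟩
        ∑[ φ ∈ colourings ] (∑[ s ∈ graphStates ] (ω α β γ s * ⟦ constantOnCurves? s φ ⟧))
          -- The factor at `v` now depends on `s` only through `lookup s v`, so the sum over states
          -- becomes a product of sums over the three vertex states.
          ≈⟨ ∑-cong colourings (λ φ → trans (∑-cong graphStates (λ s → ω-constantOnCurves s φ))
               (∑-words states (λ v x → weight α β γ x * ⟦ coherent? (colours φ v) x ⟧))) ⟩
        ∑[ φ ∈ colourings ] ∏ (λ v → localWeight (colours φ v))
          ≈⟨ ∑-filter isValuation? colourings ∏-localWeight-valuation ∏-localWeight-nonvaluation ⟩
        ∑[ φ ∈ 𝒦 G k ] ((α + β + γ) ^ tot G φ * α ^ wh G φ * β ^ bl G φ * γ ^ cr G φ) ∎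
        where
        colourings : List (Colouring {k})
        colourings = words (allFin k) Eₘ

theorem4p3 : ∀ {r ℓ} (R : CommutativeRing r ℓ) →
    let open CommutativeRing R in
    let open Transition R in
    (G : EmbeddedGraph) (α β γ : Carrier) (k : ℕ) .{{_ : NonZero k}} →
    Q G (α , β , γ) (fromℕ k) ≈
    ∑[ φ ∈ 𝒦 G k ] ((α + β + γ) ^ tot G φ * α ^ wh G φ * β ^ bl G φ * γ ^ cr G φ)
theorem4p3 R G α β γ k = Expansion.expansion R α β γ G k
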